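{- Let $r\in\{4,5\}$, let $n\ge r-1$ and $k\ge\binom{r}{2}$ be integers. Then $$\mathrm{ex}_k(n, K_r)\le\max\left\{\left(\binom{r}{2}-1\right)\binom{n}{2},\ k\cdot t_{r-1}(n)\right\}.$$
   Context: $K_r$ denotes the complete graph on $r$ vertices. $t_{r-1}(n)$ is the number of edges of the Turán graph $T_{r-1}(n)$, the complete $(r-1)$-partite graph on $n$ vertices whose part sizes differ by at most one. Let $F$ be a fixed graph with edge set $\{e_1,\dots,e_m\}$ and $k\ge m$. A multiset $\mathcal{G}_n^k=\{G_1,\dots,G_k\}$ of graphs on vertex set $[n]=\{1,\dots,n\}$ is called rainbow $F$-free if there is no set of distinct indices $\{i_1,\dots,i_m\}\subseteq[k]$ with $e_j\in G_{i_j}$ for every $j\in[m]$ (for every copy of $F$ in $K_n$, i.e. every labelling of the edges of every copy). Write $|\mathcal{G}_n^k|=\sum_{i=1}^k|E(G_i)|$. The rainbow Turán number $\mathrm{ex}_k(n,F)$ is the maximum of $|\mathcal{G}_n^k|$ over all rainbow $F$-free multisets $\mathcal{G}_n^k$ of $k$ graphs on $[n]$. -}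

module Defs where

open import Data.Nat using (ℕ; zero; suc; _+_; _<ᵇ_; _≡ᵇ_; _%_)
open import Data.Nat.Properties using (_≟_)
open import Data.Bool using (Bool; true; false; _∧_; if_then_else_; not)
open import Data.Fin using (Fin; toℕ)
open import Data.List using (List; map; allFin)
open import Data.Nat.ListAction using (sum)
open import Data.Product using (Σ; _×_; _,_)
open import Relation.Binary.PropositionalEquality using (_≡_; refl; cong)
open import Relation.Nullary using (¬_; does)
open import Data.Fin.Properties using () renaming (_≟_ to _≟F_)

record Graph (n : ℕ) : Set where
  field
    adj    : Fin n → Fin n → Bool
    sym    : ∀ i j → adj i j ≡ adj j i
    irrefl : ∀ i → adj i i ≡ false
open Graph public

edgeCount : ∀ {n} → Graph n → ℕ
edgeCount {n} G =
  sum (map (λ i → sum (map (λ j → if (toℕ i <ᵇ toℕ j) ∧ adj G i j then 1 else 0)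
                             (allFin n)))
           (allFin n))

-- A multiset {G_1,…,G_k} of graphs on [n], as an indexed family.
Family : ℕ → ℕ → Set
Family k n = Fin k → Graph n

totalEdges : ∀ {k n} → Family k n → ℕ
totalEdges {k} 𝒢 = sum (map (λ i → edgeCount (𝒢 i)) (allFin k))

RainbowKr : ∀ {k n} → ℕ → Family k n → Set
RainbowKr {k} {n} r 𝒢 =
  Σ (Fin r → Fin n) λ v →
  Σ (Fin r → Fin r → Fin k) λ c →
    (∀ a b → v a ≡ v b → a ≡ b) ×
    (∀ a b a' b' → toℕ a Data.Nat.< toℕ b → toℕ a' Data.Nat.< toℕ b' →
        c a b ≡ c a' b' → (a ≡ a') × (b ≡ b')) ×
    (∀ a b → toℕ a Data.Nat.< toℕ b → adj (𝒢 (c a b)) (v a) (v b) ≡ true)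

RainbowKrFree : ∀ {k n} → ℕ → Family k n → Set
RainbowKrFree r 𝒢 = ¬ RainbowKr r 𝒢

-- Turán graph T_s(n): vertex i lies in part (i mod s); adjacent iff in
-- different parts.  Part sizes differ by at most one.
private
  ≡ᵇ-sym : ∀ x y → (x ≡ᵇ y) ≡ (y ≡ᵇ x)
  ≡ᵇ-sym zero zero = refl
  ≡ᵇ-sym zero (suc y) = refl
  ≡ᵇ-sym (suc x) zero = refl
  ≡ᵇ-sym (suc x) (suc y) = ≡ᵇ-sym x y
  ≡ᵇ-refl : ∀ x → (x ≡ᵇ x) ≡ true
  ≡ᵇ-refl zero = refl
  ≡ᵇ-refl (suc x) = ≡ᵇ-refl x

turánGraph : (s n : ℕ) → Graph n
turánGraph zero    n = record { adj = λ _ _ → false ; sym = λ _ _ → refl ; irrefl = λ _ → refl }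
turánGraph (suc s) n = record
  { adj    = λ i j → not ((toℕ i % suc s) ≡ᵇ (toℕ j % suc s))
  ; sym    = λ i j → cong not (≡ᵇ-sym (toℕ i % suc s) (toℕ j % suc s))
  ; irrefl = λ i → cong not (≡ᵇ-refl (toℕ i % suc s))
  }

turán : ℕ → ℕ → ℕ
turán s n = edgeCount (turánGraph s n)

{-# OPTIONS --safe #-}

-- Let M = r C 2 ∸ 1.  An r-clique is rainbow as soon as, for every i ≤ M, at most i
-- of its edges lie in at most i of the graphs: colour the edges greedily.  So only the
-- multiplicities of the edges matter, and multiplicities above M may be replaced by a
-- common value q (p for each unit of a smaller one).  It suffices to treat
-- q / p ≥ M (n C 2) / t(n), since the bound is piecewise linear in q / p, and there to
-- show that the total cost is at most q t(n).  By induction on n: some edge has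
-- multiplicity above M, and a clique S is grown from it.  If the vertices outside S
-- are on average cheap towards S, then S can be deleted; otherwise some vertex y is
-- expensive towards S, which bounds the number of edges of low multiplicity between
-- y and S, and y is added to S.  For r = 4 and r = 5 these bounds add up to the greedy
-- condition when S has r vertices, a finite numerical check.
module Submission where

open import Defs hiding (sym)
open import Data.Bool using (Bool; true; false; _∧_; if_then_else_; not)
import Data.Bool.Properties as Bool
open import Data.Empty using (⊥-elim)
open import Data.Fin using (Fin; zero; suc; toℕ; fromℕ<)
import Data.Fin.Properties as Fin
open import Data.List using (List; []; _∷_; _++_; map; length; filter; allFin; lookup; upTo)
open import Data.List.Properties using (length-++; length-map; length-tabulate; length-upTo; map-++; map-cong; map-∘; map-id; map-tabulate; map-upTo; filter-all)
open import Data.List.Membership.Propositional using (_∈_; _∉_)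
open import Data.List.Membership.Propositional.Properties using (∈-++⁺ˡ; ∈-++⁺ʳ; ∈-map⁺; ∈-lookup; ∈-filter⁻)
open import Data.List.Relation.Binary.Permutation.Propositional using (_↭_; refl; prep; swap; trans; ↭-sym; ↭⇒↭ₛ)
open import Data.List.Relation.Binary.Permutation.Propositional.Properties using (↭-length; map⁺; shift; shifts; ++⁺ˡ; ∈-resp-↭)
import Data.List.Relation.Binary.Permutation.Setoid.Properties as Permutationₛ
open import Data.List.Relation.Unary.All as All using (_∷_)
import Data.List.Relation.Unary.All.Properties as All
open import Data.List.Relation.Unary.AllPairs using ([]; _∷_)
open import Data.List.Relation.Unary.Any using (here; there)
open import Data.List.Relation.Unary.Unique.Propositional using (Unique)
import Data.List.Relation.Unary.Unique.Propositional.Properties as Unique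
open import Data.Nat using (ℕ; zero; suc; _+_; _*_; _∸_; _⊔_; _≤_; _<_; z≤n; s≤s; _≤?_; _<?_; _≡ᵇ_; _<ᵇ_; _%_; >-nonZero)
open import Data.Nat.Combinatorics using (_C_; nC1≡n; nCk+nC[k+1]≡[n+1]C[k+1])
open import Data.Nat.DivMod using ([m+n]%n≡m%n; m%n<n)
open import Data.Nat.Induction using (<-rec)
open import Data.Nat.ListAction using (sum)
open import Data.Nat.ListAction.Properties using (sum-++; sum-↭)
open import Data.Nat.Properties
open import Algebra.Properties.CommutativeSemigroup +-commutativeSemigroup using (interchange)
open import Data.Nat.Tactic.RingSolver using (solve-∀)
open import Data.Product using (∃-syntax; _×_; _,_; proj₁; proj₂; uncurry)
open import Data.Product.Properties using (≡-dec; ,-injective)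
open import Data.Sum using (_⊎_; inj₁; inj₂)
open import Data.Unit using (tt)
open import Function using (_∘_; id)
open import Relation.Binary using (DecidableEquality)
open import Relation.Binary.PropositionalEquality as ≡ using (_≡_; _≢_; cong; cong₂; subst; sym; module ≡-Reasoning)
open import Relation.Nullary using (yes; no; ¬_; Dec)
open import Relation.Nullary.Decidable using (toWitness; ¬?; _×-dec_; _→-dec_)

-- Sums over vertices, over unordered pairs, and pigeonhole arguments.

pairs : ℕ → ℕ
pairs zero    = 0
pairs (suc n) = n + pairs n

module _ {A : Set} where

  sum-map-+ : ∀ (f g : A → ℕ) xs →
    sum (map (λ x → f x + g x) xs) ≡ sum (map f xs) + sum (map g xs)
  sum-map-+ f g []       = ≡.refl
  sum-map-+ f g (x ∷ xs) = ≡.trans (cong (f x + g x +_) (sum-map-+ f g xs))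
                                   (interchange (f x) (g x) _ _)

  sum-map-* : ∀ c (f : A → ℕ) xs → sum (map (λ x → c * f x) xs) ≡ c * sum (map f xs)
  sum-map-* c f []       = sym (*-zeroʳ c)
  sum-map-* c f (x ∷ xs) = ≡.trans (cong (c * f x +_) (sum-map-* c f xs))
                                   (sym (*-distribˡ-+ c (f x) _))

  sum-map-mono : ∀ {f g : A → ℕ} → (∀ x → f x ≤ g x) → ∀ xs → sum (map f xs) ≤ sum (map g xs)
  sum-map-mono f≤g []       = z≤n
  sum-map-mono f≤g (x ∷ xs) = +-mono-≤ (f≤g x) (sum-map-mono f≤g xs)

  sum-map-const : ∀ c (xs : List A) → sum (map (λ _ → c) xs) ≡ length xs * c
  sum-map-const c []       = ≡.refl
  sum-map-const c (x ∷ xs) = cong (c +_) (sum-map-const c xs)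

  -- The large element is returned at the head of a permutation, so that a vertex can be moved from
  -- the remaining vertices into a clique.
  pigeonhole : ∀ (f : A → ℕ) c xs →
    sum (map f xs) ≤ length xs * c ⊎ ∃[ y ] ∃[ ys ] xs ↭ y ∷ ys × c < f y
  pigeonhole f c [] = inj₁ z≤n
  pigeonhole f c (x ∷ xs) with f x ≤? c | pigeonhole f c xs
  ... | no  fx≰c | _         = inj₂ (x , xs , refl , ≰⇒> fx≰c)
  ... | yes fx≤c | inj₁ le   = inj₁ (+-mono-≤ fx≤c le)
  ... | yes fx≤c | inj₂ (y , ys , p , lt) =
    inj₂ (y , x ∷ ys , trans (prep x p) (swap x y refl) , lt)

  pairSum : (A → A → ℕ) → List A → ℕ
  pairSum f []       = 0
  pairSum f (x ∷ xs) = sum (map (f x) xs) + pairSum f xs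

  -- Grouped by the vertices of `ys`, the form to which `pigeonhole` applies.
  crossSum : (A → A → ℕ) → List A → List A → ℕ
  crossSum f xs ys = sum (map (λ y → sum (map (f y) xs)) ys)

  pairSum-cong : ∀ {f g : A → A → ℕ} → (∀ x y → f x y ≡ g x y) → ∀ xs → pairSum f xs ≡ pairSum g xs
  pairSum-cong f≡g []       = ≡.refl
  pairSum-cong f≡g (x ∷ xs) = cong₂ _+_ (cong sum (map-cong (f≡g x) xs)) (pairSum-cong f≡g xs)

  pairSum-mono : ∀ {f g : A → A → ℕ} → (∀ x y → f x y ≤ g x y) → ∀ xs → pairSum f xs ≤ pairSum g xs
  pairSum-mono f≤g []       = z≤n
  pairSum-mono f≤g (x ∷ xs) = +-mono-≤ (sum-map-mono (f≤g x) xs) (pairSum-mono f≤g xs)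

  pairSum-+ : ∀ (f g : A → A → ℕ) xs →
    pairSum (λ x y → f x y + g x y) xs ≡ pairSum f xs + pairSum g xs
  pairSum-+ f g []       = ≡.refl
  pairSum-+ f g (x ∷ xs) =
    ≡.trans (cong₂ _+_ (sum-map-+ (f x) (g x) xs) (pairSum-+ f g xs))
            (interchange (sum (map (f x) xs)) _ _ _)

  pairSum-* : ∀ c (f : A → A → ℕ) xs → pairSum (λ x y → c * f x y) xs ≡ c * pairSum f xs
  pairSum-* c f []       = sym (*-zeroʳ c)
  pairSum-* c f (x ∷ xs) =
    ≡.trans (cong₂ _+_ (sum-map-* c (f x) xs) (pairSum-* c f xs))
            (sym (*-distribˡ-+ c (sum (map (f x) xs)) _))

  pairSum-const : ∀ c (xs : List A) → pairSum (λ _ _ → c) xs ≡ pairs (length xs) * c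
  pairSum-const c []       = ≡.refl
  pairSum-const c (x ∷ xs) =
    ≡.trans (cong₂ _+_ (sum-map-const c xs) (pairSum-const c xs))
            (sym (*-distribʳ-+ c (length xs) _))

  pairSum-↭ : ∀ (f : A → A → ℕ) → (∀ x y → f x y ≡ f y x) →
    ∀ {xs ys} → xs ↭ ys → pairSum f xs ≡ pairSum f ys
  pairSum-↭ f f-sym refl = ≡.refl
  pairSum-↭ f f-sym (prep x p) =
    cong₂ _+_ (sum-↭ (map⁺ (f x) p)) (pairSum-↭ f f-sym p)
  pairSum-↭ f f-sym {xs = _ ∷ _ ∷ xs} {ys = _ ∷ _ ∷ ys} (swap x y p) = begin
    (f x y + sx) + (sy + s)   ≡⟨ interchange (f x y) sx sy s ⟩
    (f x y + sy) + (sx + s)   ≡⟨ cong₂ _+_ (cong₂ _+_ (f-sym x y) (sum-↭ (map⁺ (f y) p)))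
                                           (cong₂ _+_ (sum-↭ (map⁺ (f x) p)) (pairSum-↭ f f-sym p)) ⟩
    (f y x + sum (map (f y) ys)) + (sum (map (f x) ys) + pairSum f ys) ∎
    where
    open ≡-Reasoning
    sx = sum (map (f x) xs)
    sy = sum (map (f y) xs)
    s  = pairSum f xs
  pairSum-↭ f f-sym (trans p q) = ≡.trans (pairSum-↭ f f-sym p) (pairSum-↭ f f-sym q)

  pairSum-++ : ∀ (f : A → A → ℕ) → (∀ x y → f x y ≡ f y x) → ∀ xs ys →
    pairSum f (xs ++ ys) ≡ pairSum f xs + crossSum f xs ys + pairSum f ys
  pairSum-++ f f-sym [] ys =
    cong (_+ pairSum f ys) (sym (≡.trans (sum-map-const 0 ys) (*-zeroʳ (length ys))))
  pairSum-++ f f-sym (x ∷ xs) ys = begin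
    sum (map (f x) (xs ++ ys)) + pairSum f (xs ++ ys)
      ≡⟨ cong₂ _+_ (≡.trans (cong sum (map-++ (f x) xs ys)) (sum-++ (map (f x) xs) _))
                   (pairSum-++ f f-sym xs ys) ⟩
    (a + b) + (c + d + e)
      ≡⟨ regroup a b c d e ⟩
    (a + c) + (b + d) + e
      ≡⟨ cong (λ u → (a + c) + u + e)
           (≡.trans (cong (_+ d) (cong sum (map-cong (f-sym x) ys)))
                    (sym (sum-map-+ (λ y → f y x) _ ys))) ⟩
    (a + c) + crossSum f (x ∷ xs) ys + e ∎
    where
    open ≡-Reasoning
    a = sum (map (f x) xs)
    b = sum (map (f x) ys)
    c = pairSum f xs
    d = crossSum f xs ys
    e = pairSum f ys
    regroup : ∀ a b c d e → (a + b) + (c + d + e) ≡ (a + c) + (b + d) + e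
    regroup = solve-∀

  pairSum-pigeonhole : ∀ (f : A → A → ℕ) c xs →
    pairSum f xs ≤ pairs (length xs) * c ⊎ ∃[ x ] ∃[ y ] ∃[ zs ] xs ↭ x ∷ y ∷ zs × c < f x y
  pairSum-pigeonhole f c [] = inj₁ z≤n
  pairSum-pigeonhole f c (x ∷ xs) with pigeonhole (f x) c xs
  ... | inj₂ (y , ys , p , lt) = inj₂ (x , y , ys , prep x p , lt)
  ... | inj₁ le with pairSum-pigeonhole f c xs
  ...   | inj₁ le′ = inj₁ (≤-trans (+-mono-≤ le le′)
                             (≤-reflexive (sym (*-distribʳ-+ c (length xs) _))))
  ...   | inj₂ (u , v , zs , p , lt) =
    inj₂ (u , v , x ∷ zs , trans (prep x p) (↭-sym (shift x (u ∷ v ∷ []) zs)) , lt)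

-- Light and heavy multiplicities and their costs.

indicator≤ : ℕ → ℕ → ℕ
indicator≤ i w with w ≤? i
... | yes _ = 1
... | no  _ = 0

indicator≤-zero : ∀ {i w} → i < w → indicator≤ i w ≡ 0
indicator≤-zero {i} {w} i<w with w ≤? i
... | yes w≤i = ⊥-elim (<⇒≱ i<w w≤i)
... | no  _   = ≡.refl

light : ℕ → ℕ → ℕ
light M w with w ≤? M
... | yes _ = w
... | no  _ = 0

heavy : ℕ → ℕ → ℕ
heavy M w with w ≤? M
... | yes _ = 0
... | no  _ = 1

-- Linear in `p` and `q`: a total cost is `p * a + q * b` with `a`, `b` independent of `p` and `q`,
-- which makes interpolation possible.
cost : (M p q w : ℕ) → ℕ
cost M p q w = p * light M w + q * heavy M w

cost-light : ∀ M p q {w} → w ≤ M → cost M p q w ≡ p * w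
cost-light M p q {w} w≤M with w ≤? M
... | yes _   = ≡.trans (cong (p * w +_) (*-zeroʳ q)) (+-identityʳ _)
... | no  w≰M = ⊥-elim (w≰M w≤M)

cost-heavy : ∀ M p q {w} → M < w → cost M p q w ≡ q
cost-heavy M p q {w} M<w with w ≤? M
... | yes w≤M = ⊥-elim (<⇒≱ M<w w≤M)
... | no  _   = ≡.trans (cong (_+ q * 1) (*-zeroʳ p)) (*-identityʳ q)

cost-≤ : ∀ M p q → p * M ≤ q → ∀ w → cost M p q w ≤ q
cost-≤ M p q pM≤q w with ≤-<-connex w M
... | inj₁ w≤M = ≤-trans (≤-reflexive (cost-light M p q w≤M)) (≤-trans (*-monoʳ-≤ p w≤M) pM≤q)
... | inj₂ M<w = ≤-reflexive (cost-heavy M p q M<w)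

≤-cost : ∀ M {k w} → w ≤ k → w ≤ cost M 1 k w
≤-cost M {k} {w} w≤k with ≤-<-connex w M
... | inj₁ w≤M = ≤-reflexive (sym (≡.trans (cost-light M 1 k w≤M) (*-identityˡ w)))
... | inj₂ M<w = ≤-trans w≤k (≤-reflexive (sym (cost-heavy M 1 k M<w)))

cost->⇒heavy : ∀ M p q w → p * M < cost M p q w → M < w
cost->⇒heavy M p q w pM<c with ≤-<-connex w M
... | inj₂ M<w = M<w
... | inj₁ w≤M = ⊥-elim (<⇒≱ pM<c (≤-trans (≤-reflexive (cost-light M p q w≤M)) (*-monoʳ-≤ p w≤M)))

-- Thresholds for extending a clique.

-- A clique S with s vertices is extended by a vertex whose edges to S have total
-- cost exceeding (B s / A s) q, under the assumption q / p ≥ β / α.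
record Scheme : Set where
  field
    A B : ℕ → ℕ
    α β : ℕ

module Counting (σ : Scheme) where
  open Scheme σ

  -- c edges of cost at most i p and s ∸ c edges of cost at most q cannot exceed the
  -- threshold; the term s ∸ c is moved to the right to avoid truncated subtraction.
  Excluded : (s i c : ℕ) → Set
  Excluded s i c = A s * c * i * α + A s * s * β ≤ (B s + A s * c) * β

  excluded? : ∀ s i c → Dec (Excluded s i c)
  excluded? s i c = A s * c * i * α + A s * s * β ≤? (B s + A s * c) * β

  -- A downward search from `c`; being computable, it turns the greedy condition into a check by
  -- evaluation.
  maxLight : (s i c : ℕ) → ℕ
  maxLight s i zero    = 0
  maxLight s i (suc c) with excluded? s i (suc c)
  ... | yes _ = maxLight s i c
  ... | no  _ = suc c

  ≤-maxLight : ∀ s i {c} m → c ≤ m → ¬ Excluded s i c → c ≤ maxLight s i m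
  ≤-maxLight s i zero    c≤m ¬ex = c≤m
  ≤-maxLight s i (suc m) c≤m ¬ex with excluded? s i (suc m)
  ... | no  _  = c≤m
  ... | yes ex with m≤n⇒m<n∨m≡n c≤m
  ...   | inj₁ (s≤s c≤m′) = ≤-maxLight s i m c≤m′ ¬ex
  ...   | inj₂ ≡.refl     = ⊥-elim (¬ex ex)

  -- One summand for each size from 2 to `r ∸ 1` at which a vertex is added. The initial edge
  -- contributes nothing: its multiplicity is above `M`, hence above `i`.
  lightBound : (r i : ℕ) → ℕ
  lightBound (suc s@(suc (suc _))) i = maxLight s i s + lightBound s i
  lightBound _                     i = 0

-- Up to the factor `q / A s`: the edges inside S at `q` each, an average star of `(B s / A s) q`
-- from each outside vertex, and the inductive bound for the rest fit into `q * t ℓ`.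
Deletable : (t : ℕ → ℕ) → Scheme → (s ℓ : ℕ) → Set
Deletable t σ s ℓ = A s * (pairs s + t (ℓ ∸ s)) + B s * (ℓ ∸ s) ≤ A s * t ℓ
  where open Scheme σ

-- Growing a clique or deleting it.

module Growth {V : Set} (w : V → V → ℕ) (w-sym : ∀ x y → w x y ≡ w y x)
              (M p q : ℕ) (pM≤q : p * M ≤ q) (t : ℕ → ℕ) where

  h : V → V → ℕ
  h x y = cost M p q (w x y)

  h-sym : ∀ x y → h x y ≡ h y x
  h-sym x y = cong (cost M p q) (w-sym x y)

  numLight : ℕ → List V → V → ℕ
  numLight i S y = sum (map (λ x → indicator≤ i (w y x)) S)

  numLight-≤ : ∀ i S y → numLight i S y ≤ length S
  numLight-≤ i []      y = z≤n
  numLight-≤ i (x ∷ S) y with w y x ≤? i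
  ... | yes _ = s≤s (numLight-≤ i S y)
  ... | no  _ = m≤n⇒m≤1+n (numLight-≤ i S y)

  -- With c edges of multiplicity at most `i`, these cost at most `p * i` each because `i ≤ M`, and
  -- the others at most `q`. The summand c q on the left replaces a subtraction on the right.
  starCost-≤ : ∀ {i} → i ≤ M → ∀ S y →
    sum (map (h y) S) + numLight i S y * q ≤ numLight i S y * (p * i) + length S * q
  starCost-≤ {i} i≤M []      y = z≤n
  starCost-≤ {i} i≤M (x ∷ S) y with w y x ≤? i
  ... | yes w≤i = begin
    (h y x + a) + (q + c * q)              ≡⟨ shuffle (h y x) a q (c * q) ⟩
    (h y x + q) + (a + c * q)              ≤⟨ +-mono-≤ (+-monoˡ-≤ q h≤) (starCost-≤ i≤M S y) ⟩
    (p * i + q) + (c * (p * i) + l * q)    ≡⟨ shuffle (p * i) q (c * (p * i)) (l * q) ⟩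
    (p * i + c * (p * i)) + (q + l * q)    ∎
    where
    open ≤-Reasoning
    a = sum (map (h y) S)
    c = numLight i S y
    l = length S
    shuffle : ∀ a b c d → (a + b) + (c + d) ≡ (a + c) + (b + d)
    shuffle = solve-∀
    h≤ : h y x ≤ p * i
    h≤ = ≤-trans (≤-reflexive (cost-light M p q (≤-trans w≤i i≤M))) (*-monoʳ-≤ p w≤i)
  ... | no  _   = begin
    (h y x + a) + c * q                    ≡⟨ +-assoc (h y x) a _ ⟩
    h y x + (a + c * q)                    ≤⟨ +-mono-≤ (cost-≤ M p q pM≤q (w y x)) (starCost-≤ i≤M S y) ⟩
    q + (c * (p * i) + l * q)              ≡⟨ shuffle q (c * (p * i)) (l * q) ⟩
    c * (p * i) + (q + l * q)              ∎
    where
    open ≤-Reasoning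
    a = sum (map (h y) S)
    c = numLight i S y
    l = length S
    shuffle : ∀ a b c → a + (b + c) ≡ b + (a + c)
    shuffle = solve-∀

  module _ (σ : Scheme) (0<β : 0 < Scheme.β σ) (βp≤αq : Scheme.β σ * p ≤ Scheme.α σ * q) where
    open Scheme σ
    open Counting σ

    -- `Excluded` is the bound of `starCost-≤` with `p` raised to `(α / β) q` and denominators
    -- cleared; it would force the star to stay below its threshold.
    starCost-excluded : ∀ {i} → i ≤ M → ∀ S y (let s = length S) →
      B s * q < A s * sum (map (h y) S) → ¬ Excluded s i (numLight i S y)
    starCost-excluded {i} i≤M S y large ex = <⇒≱ large
      (*-cancelˡ-≤ β {{>-nonZero 0<β}} (+-cancelʳ-≤ (β * (A s * c * q)) _ _ (begin
        β * (A s * a) + β * (A s * c * q)                ≡⟨ eq₁ β (A s) a c q ⟩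
        β * (A s * (a + c * q))                          ≤⟨ *-monoʳ-≤ β (*-monoʳ-≤ (A s) (starCost-≤ i≤M S y)) ⟩
        β * (A s * (c * (p * i) + s * q))                ≡⟨ eq₂ β (A s) c p i s q ⟩
        A s * c * i * (β * p) + A s * s * β * q          ≤⟨ +-monoˡ-≤ _ (*-monoʳ-≤ (A s * c * i) βp≤αq) ⟩
        A s * c * i * (α * q) + A s * s * β * q          ≡⟨ eq₃ (A s * c * i) α q (A s * s * β) ⟩
        (A s * c * i * α + A s * s * β) * q              ≤⟨ *-monoˡ-≤ q ex ⟩
        (B s + A s * c) * β * q                          ≡⟨ eq₄ (B s) (A s) c β q ⟩
        β * (B s * q) + β * (A s * c * q)                ∎)))
      where
      open ≤-Reasoning
      a = sum (map (h y) S)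
      c = numLight i S y
      s = length S
      eq₁ : ∀ β A a c q → β * (A * a) + β * (A * c * q) ≡ β * (A * (a + c * q))
      eq₁ = solve-∀
      eq₂ : ∀ β A c p i s q → β * (A * (c * (p * i) + s * q)) ≡ A * c * i * (β * p) + A * s * β * q
      eq₂ = solve-∀
      eq₃ : ∀ x α q y → x * (α * q) + y * q ≡ (x * α + y) * q
      eq₃ = solve-∀
      eq₄ : ∀ B A c β q → (B + A * c) * β * q ≡ β * (B * q) + β * (A * c * q)
      eq₄ = solve-∀

    data Grown : List V → Set where
      edge : ∀ {u v} → M < w u v → Grown (u ∷ v ∷ [])
      grow : ∀ {y S} → Grown S → B (length S) * q < A (length S) * sum (map (h y) S) → Grown (y ∷ S)

    -- Every pair other than the initial edge is counted once, in the star of whichever endpoint was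
    -- added later, and each such star was expensive when added.
    Grown-light : ∀ {i} → i ≤ M → ∀ {S} → Grown S →
      pairSum (λ x y → indicator≤ i (w x y)) S ≤ lightBound (length S) i
    Grown-light {i} i≤M (edge {u} {v} M<w) =
      ≤-reflexive (cong (λ z → z + 0 + 0) (indicator≤-zero (≤-<-trans i≤M M<w)))
    Grown-light {i} i≤M (grow {y} {S@(_ ∷ _ ∷ S′)} g large) = +-mono-≤
      (≤-maxLight (length S) i (length S) (numLight-≤ i S y) (starCost-excluded i≤M S y large))
      (Grown-light i≤M g)
    Grown-light {i} i≤M (grow {S = _ ∷ []} (grow () _) _)

    -- Pigeonhole over the outside vertices on `A s` times the star cost: without an expensive star
    -- the edges between S and the rest are cheap in total, and `Deletable` closes the induction.
    grow-or-delete : ∀ vs S vs′ → vs ↭ S ++ vs′ →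
      0 < A (length S) → Deletable t σ (length S) (length vs) →
      pairSum h vs′ ≤ q * t (length vs′) →
      pairSum h vs ≤ q * t (length vs) ⊎
      ∃[ y ] ∃[ vs″ ] vs ↭ (y ∷ S) ++ vs″ × B (length S) * q < A (length S) * sum (map (h y) S)
    grow-or-delete vs S vs′ perm 0<A del ih
      with pigeonhole (λ y → A (length S) * sum (map (h y) S)) (B (length S) * q) vs′
    ... | inj₂ (y , vs″ , perm′ , large) =
      inj₂ (y , vs″ , trans perm (trans (++⁺ˡ S perm′) (shift y S vs″)) , large)
    ... | inj₁ small = inj₁ (*-cancelˡ-≤ a {{>-nonZero 0<A}} (begin
      a * pairSum h vs
        ≡⟨ cong (a *_) (≡.trans (pairSum-↭ h h-sym perm) (pairSum-++ h h-sym S vs′)) ⟩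
      a * (pairSum h S + crossSum h S vs′ + pairSum h vs′)
        ≡⟨ eq₁ a (pairSum h S) (crossSum h S vs′) _ ⟩
      a * pairSum h S + a * crossSum h S vs′ + a * pairSum h vs′
        ≤⟨ +-mono-≤ (+-mono-≤ (*-monoʳ-≤ a inner≤) cross≤) (*-monoʳ-≤ a ih) ⟩
      a * (pairs s * q) + length vs′ * (B s * q) + a * (q * t (length vs′))
        ≡⟨ eq₂ a (pairs s) q (length vs′) (B s) _ ⟩
      q * (a * (pairs s + t (length vs′)) + B s * length vs′)
        ≤⟨ *-monoʳ-≤ q (subst (λ l → a * (pairs s + t l) + B s * l ≤ a * t (length vs)) rest del) ⟩
      q * (a * t (length vs))
        ≡⟨ eq₃ q a _ ⟩
      a * (q * t (length vs)) ∎))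
      where
      open ≤-Reasoning
      s = length S
      a = A s
      inner≤ : pairSum h S ≤ pairs s * q
      inner≤ = ≤-trans (pairSum-mono (λ x y → cost-≤ M p q pM≤q (w x y)) S)
                       (≤-reflexive (pairSum-const q S))
      rest : length vs ∸ s ≡ length vs′
      rest = ≡.trans (cong (_∸ s) (≡.trans (↭-length perm) (length-++ S))) (m+n∸m≡n s (length vs′))
      cross≤ : a * crossSum h S vs′ ≤ length vs′ * (B s * q)
      cross≤ = ≤-trans (≤-reflexive (sym (sum-map-* a _ vs′))) small
      eq₁ : ∀ a b c d → a * (b + c + d) ≡ a * b + a * c + a * d
      eq₁ = solve-∀
      eq₂ : ∀ a b q l B t → a * (b * q) + l * (B * q) + a * (q * t) ≡ q * (a * (b + t) + B * l)
      eq₂ = solve-∀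
      eq₃ : ∀ q a t → q * (a * t) ≡ a * (q * t)
      eq₃ = solve-∀

    module _ (vs : List V)
             (ih : ∀ S vs′ → vs ↭ S ++ vs′ → 2 ≤ length S → pairSum h vs′ ≤ q * t (length vs′))
             (r : ℕ)
             (ok : ∀ s → 2 ≤ s → s < r → 0 < A s × Deletable t σ s (length vs)) where

      Grows : Set
      Grows = pairSum h vs ≤ q * t (length vs) ⊎ ∃[ S ] ∃[ vs′ ] vs ↭ S ++ vs′ × Grown S × length S ≡ r

      growFrom : ∀ d S vs′ → vs ↭ S ++ vs′ → Grown S → 2 ≤ length S → d + length S ≡ r → Grows
      growFrom zero    S vs′ perm g 2≤s eq = inj₂ (S , vs′ , perm , g , eq)
      growFrom (suc d) S vs′ perm g 2≤s eq
        with s<r ← ≤-trans (s≤s (m≤n+m (length S) d)) (≤-reflexive eq)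
        with grow-or-delete vs S vs′ perm (proj₁ (ok _ 2≤s s<r)) (proj₂ (ok _ 2≤s s<r))
                            (ih S vs′ perm 2≤s)
      ... | inj₁ le = inj₁ le
      ... | inj₂ (y , vs″ , perm′ , large) =
        growFrom d (y ∷ S) vs″ perm′ (grow g large) (m≤n⇒m≤1+n 2≤s)
                 (≡.trans (+-suc d (length S)) eq)

      -- If the average cost is at most `p * M`, the density hypothesis already gives the bound.
      -- Otherwise some edge costs more than any light edge can, and the clique starts there.
      grows : 2 ≤ r → p * M * pairs (length vs) ≤ q * t (length vs) → Grows
      grows 2≤r dense with pairSum-pigeonhole h (p * M) vs
      ... | inj₁ le = inj₁ (≤-trans le (≤-trans (≤-reflexive (*-comm (pairs (length vs)) _)) dense))
      ... | inj₂ (u , v , vs′ , perm , lt) =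
        growFrom (r ∸ 2) (u ∷ v ∷ []) vs′ perm (edge (cost->⇒heavy M p q (w u v) lt))
                 ≤-refl (m∸n+n≡m 2≤r)

-- Arithmetic of the Turán numbers.

2*pairs : ∀ n → 2 * pairs (suc n) ≡ suc n * n
2*pairs zero    = ≡.refl
2*pairs (suc n) = begin
  2 * (suc n + pairs (suc n))     ≡⟨ *-distribˡ-+ 2 (suc n) _ ⟩
  2 * suc n + 2 * pairs (suc n)   ≡⟨ cong (2 * suc n +_) (2*pairs n) ⟩
  2 * suc n + suc n * n           ≡⟨ eq n ⟩
  suc (suc n) * suc n             ∎
  where
  open ≡-Reasoning
  eq : ∀ n → 2 * (1 + n) + (1 + n) * n ≡ (2 + n) * (1 + n)
  eq = solve-∀

-- Reduces claims about Turán numbers to the values within one period, which evaluation decides.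
periodic-induction : ∀ K (P : ℕ → Set) → (∀ {n} → n < suc K → P n) → (∀ n → P n → P (suc K + n)) → ∀ n → P n
periodic-induction K P base step = <-rec P λ n rec → go n rec (n <? suc K)
  where
  go : ∀ n → (∀ {m} → m < n → P m) → Dec (n < suc K) → P n
  go n rec (yes n<N) = base n<N
  go n rec (no  n≮N) = subst P (m+[n∸m]≡n N≤n) (step (n ∸ suc K) (rec (∸-monoʳ-< (s≤s z≤n) N≤n)))
    where
    N≤n : suc K ≤ n
    N≤n = ≮⇒≥ n≮N

-- t-step removes one vertex from each of the suc K parts.
module TuránSequence (K : ℕ) (t : ℕ → ℕ)
  (t-step : ∀ n → t (suc K + n) ≡ t n + (K * n + pairs (suc K)))
  where

  private
    N : ℕ
    N = suc K

    -- The increment from `1 + x` to `2 + x` vertices is at most `K (x + 2) / N`; Turán numbers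
    -- attain this when `N` divides `2 + x`.
    Slope : ℕ → Set
    Slope x = N * t (2 + x) ≤ N * t (1 + x) + (K * x + 2 * K)

    -- For positive `x`, the inequality `t (2 + x) / pairs (2 + x) ≤ t (1 + x) / pairs (1 + x)` with
    -- common factors cancelled.
    Ratio : ℕ → Set
    Ratio x = x * t (2 + x) ≤ (2 + x) * t (1 + x)

    -- `Deletable` with threshold `(K / N) s`, the average number of neighbours among `s` vertices
    -- when there are `N` equal parts.
    Deletion : ℕ → ℕ → Set
    Deletion s n = N * (pairs s + t n) + K * s * n ≤ N * t (s + n)

    t-shift : ∀ s n → t (s + (N + n)) ≡ t (s + n) + (K * (s + n) + pairs N)
    t-shift s n = ≡.trans (cong t (eq s N n)) (t-step (s + n))
      where
      eq : ∀ s N n → s + (N + n) ≡ N + (s + n)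
      eq = solve-∀

  slope? : ∀ x → Dec (Slope x)
  slope? x = N * t (2 + x) ≤? N * t (1 + x) + (K * x + 2 * K)

  ratio? : ∀ x → Dec (Ratio x)
  ratio? x = x * t (2 + x) ≤? (2 + x) * t (1 + x)

  deletion? : ∀ s n → Dec (Deletion s n)
  deletion? s n = N * (pairs s + t n) + K * s * n ≤? N * t (s + n)

  slope : (∀ {x} → x < N → Slope x) → ∀ x → Slope x
  slope base = periodic-induction K Slope base λ x ih → begin
    N * t (2 + (N + x))
      ≡⟨ cong (N *_) (t-shift 2 x) ⟩
    N * (t (2 + x) + (K * (2 + x) + pairs N))
      ≡⟨ *-distribˡ-+ N (t (2 + x)) _ ⟩
    N * t (2 + x) + N * (K * (2 + x) + pairs N)
      ≤⟨ +-monoˡ-≤ _ ih ⟩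
    N * t (1 + x) + (K * x + 2 * K) + N * (K * (2 + x) + pairs N)
      ≡⟨ eq K x (t (1 + x)) (pairs N) ⟩
    N * (t (1 + x) + (K * (1 + x) + pairs N)) + (K * (N + x) + 2 * K)
      ≡⟨ cong (λ z → N * z + (K * (N + x) + 2 * K)) (sym (t-shift 1 x)) ⟩
    N * t (1 + (N + x)) + (K * (N + x) + 2 * K) ∎
    where
    open ≤-Reasoning
    eq : ∀ K x t P → (1 + K) * t + (K * x + 2 * K) + (1 + K) * (K * (2 + x) + P) ≡
                     (1 + K) * (t + (K * (1 + x) + P)) + (K * (1 + K + x) + 2 * K)
    eq = solve-∀

  -- A period raises the factor `x` to `N + x`; the extra `N * t (2 + x)` is controlled by `Slope`,
  -- and `2 * pairs N ≡ N * K` balances the remaining terms.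
  ratio : (∀ x → Slope x) → (∀ {x} → x < N → Ratio x) → ∀ x → Ratio x
  ratio slopes base = periodic-induction K Ratio base λ x ih → begin
    (N + x) * t (2 + (N + x))
      ≡⟨ cong ((N + x) *_) (t-shift 2 x) ⟩
    (N + x) * (t (2 + x) + (K * (2 + x) + pairs N))
      ≡⟨ eq₁ K x (t (2 + x)) (pairs N) ⟩
    x * t (2 + x) + N * t (2 + x) + ((N + x) * (K * (2 + x)) + (N + x) * pairs N)
      ≤⟨ +-monoˡ-≤ _ (+-mono-≤ ih (slopes x)) ⟩
    (2 + x) * t (1 + x) + (N * t (1 + x) + (K * x + 2 * K)) + ((N + x) * (K * (2 + x)) + (N + x) * pairs N)
      ≡⟨ eq₂ K x (t (1 + x)) (pairs N) ⟩
    (2 + (N + x)) * (t (1 + x) + K * (1 + x)) + (N + x) * pairs N + N * K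
      ≡⟨ cong ((2 + (N + x)) * (t (1 + x) + K * (1 + x)) + (N + x) * pairs N +_) (sym (2*pairs K)) ⟩
    (2 + (N + x)) * (t (1 + x) + K * (1 + x)) + (N + x) * pairs N + 2 * pairs N
      ≡⟨ eq₃ K x (t (1 + x)) (pairs N) ⟩
    (2 + (N + x)) * (t (1 + x) + (K * (1 + x) + pairs N))
      ≡⟨ cong ((2 + (N + x)) *_) (sym (t-shift 1 x)) ⟩
    (2 + (N + x)) * t (1 + (N + x)) ∎
    where
    open ≤-Reasoning
    eq₁ : ∀ K x t P → (1 + K + x) * (t + (K * (2 + x) + P)) ≡
                      x * t + (1 + K) * t + ((1 + K + x) * (K * (2 + x)) + (1 + K + x) * P)
    eq₁ = solve-∀
    eq₂ : ∀ K x t P →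
      (2 + x) * t + ((1 + K) * t + (K * x + 2 * K)) + ((1 + K + x) * (K * (2 + x)) + (1 + K + x) * P) ≡
      (2 + (1 + K + x)) * (t + K * (1 + x)) + (1 + K + x) * P + (1 + K) * K
    eq₂ = solve-∀
    eq₃ : ∀ K x t P → (2 + (1 + K + x)) * (t + K * (1 + x)) + (1 + K + x) * P + 2 * P ≡
                      (2 + (1 + K + x)) * (t + (K * (1 + x) + P))
    eq₃ = solve-∀

  -- A period in `n` increases both sides by `N * (K * (s + n) + pairs N)`.
  deletion : ∀ s → (∀ {n} → n < N → Deletion s n) → ∀ n → Deletion s n
  deletion s base = periodic-induction K (Deletion s) base λ n ih → begin
    N * (pairs s + t (N + n)) + K * s * (N + n)
      ≡⟨ cong (λ z → N * (pairs s + z) + K * s * (N + n)) (t-step n) ⟩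
    N * (pairs s + (t n + (K * n + pairs N))) + K * s * (N + n)
      ≡⟨ eq K (pairs s) (t n) n (pairs N) s ⟩
    N * (pairs s + t n) + K * s * n + N * (K * (s + n) + pairs N)
      ≤⟨ +-monoˡ-≤ _ ih ⟩
    N * t (s + n) + N * (K * (s + n) + pairs N)
      ≡⟨ sym (*-distribˡ-+ N (t (s + n)) _) ⟩
    N * (t (s + n) + (K * (s + n) + pairs N))
      ≡⟨ cong (N *_) (sym (t-shift s n)) ⟩
    N * t (s + (N + n)) ∎
    where
    open ≤-Reasoning
    eq : ∀ K p t n P s → (1 + K) * (p + (t + (K * n + P))) + K * s * (1 + K + n) ≡
                         (1 + K) * (p + t) + K * s * n + (1 + K) * (K * (s + n) + P)
    eq = solve-∀

  -- t ℓ / pairs ℓ is nonincreasing.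
  dense-step : (∀ x → Ratio x) → ∀ c q ℓ → c * pairs (suc ℓ) ≤ q * t (suc ℓ) → c * pairs ℓ ≤ q * t ℓ
  dense-step ratios c q zero    dense = ≤-trans (≤-reflexive (*-zeroʳ c)) z≤n
  dense-step ratios c q (suc x) dense = *-cancelˡ-≤ (2 * pairs (2 + x)) (begin
    2 * pairs (2 + x) * (c * pairs (1 + x))       ≡⟨ eq₁ (pairs (2 + x)) c (pairs (1 + x)) ⟩
    c * pairs (2 + x) * (2 * pairs (1 + x))       ≤⟨ *-mono-≤ dense (≤-reflexive (2*pairs x)) ⟩
    q * t (2 + x) * (suc x * x)                   ≡⟨ eq₂ q (t (2 + x)) x ⟩
    suc x * q * (x * t (2 + x))                   ≤⟨ *-monoʳ-≤ (suc x * q) (ratios x) ⟩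
    suc x * q * ((2 + x) * t (1 + x))             ≡⟨ eq₃ x q (t (1 + x)) ⟩
    (2 + x) * suc x * (q * t (1 + x))             ≡⟨ cong (_* (q * t (1 + x))) (sym (2*pairs (suc x))) ⟩
    2 * pairs (2 + x) * (q * t (1 + x)) ∎)
    where
    open ≤-Reasoning
    eq₁ : ∀ a c b → 2 * a * (c * b) ≡ c * a * (2 * b)
    eq₁ = solve-∀
    eq₂ : ∀ q t x → q * t * ((1 + x) * x) ≡ (1 + x) * q * (x * t)
    eq₂ = solve-∀
    eq₃ : ∀ x q t → (1 + x) * q * ((2 + x) * t) ≡ (2 + x) * (1 + x) * (q * t)
    eq₃ = solve-∀

  dense-≤ : (∀ x → Ratio x) → ∀ c q {ℓ ℓ′} → ℓ′ ≤ ℓ → c * pairs ℓ ≤ q * t ℓ → c * pairs ℓ′ ≤ q * t ℓ′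
  dense-≤ ratios c q {ℓ} ℓ′≤ℓ dense with m≤n⇒m<n∨m≡n ℓ′≤ℓ
  ... | inj₂ ≡.refl = dense
  dense-≤ ratios c q {suc ℓ} _ dense | inj₁ (s≤s ℓ′≤ℓ) =
    dense-≤ ratios c q ℓ′≤ℓ (dense-step ratios c q ℓ dense)

-- Induction on the number of vertices above the critical ratio.

module Critical (K M : ℕ) (t : ℕ → ℕ) where

  private
    r = 2 + K

  -- The ratio `β / α` is the least value of `q / p` that density on `ℓ₀` vertices permits.
  scheme : (A B : ℕ → ℕ) (ℓ₀ : ℕ) → Scheme
  scheme A B ℓ₀ = record { A = A ; B = B ; α = t ℓ₀ ; β = M * pairs ℓ₀ }

  Valid : Scheme → ℕ → Set
  Valid σ ℓ = ∀ {s} → s < r → 2 ≤ s → 0 < Scheme.A σ s × Deletable t σ s ℓ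

  valid? : ∀ σ ℓ → Dec (Valid σ ℓ)
  valid? σ ℓ = allUpTo? (λ s → (2 ≤? s) →-dec ((0 <? Scheme.A σ s) ×-dec
    (Scheme.A σ s * (pairs s + t (ℓ ∸ s)) + Scheme.B σ s * (ℓ ∸ s) ≤? Scheme.A σ s * t ℓ))) r

  Rainbow : Scheme → Set
  Rainbow σ = ∀ {i} → i < suc M → Counting.lightBound σ r i ≤ i

  rainbow? : ∀ σ → Dec (Rainbow σ)
  rainbow? σ = allUpTo? (λ i → Counting.lightBound σ r i ≤? i) (suc M)

  -- Density on `ℓ` vertices implies density on `ℓ₀ ≤ ℓ`, so one numerical check at `ℓ₀` can serve
  -- all larger `ℓ`.
  record SchemeFor (ℓ : ℕ) : Set where
    field
      {A B}   : ℕ → ℕ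
      ℓ₀      : ℕ
      ℓ₀≤ℓ    : ℓ₀ ≤ ℓ
      0<β     : 0 < M * pairs ℓ₀
      valid   : Valid (scheme A B ℓ₀) ℓ
      rainbow : Rainbow (scheme A B ℓ₀)

  module _
    (t-small : ∀ {ℓ} → ℓ < r → t ℓ ≡ pairs ℓ)
    (dense-≤ : ∀ c q {ℓ ℓ′} → ℓ′ ≤ ℓ → c * pairs ℓ ≤ q * t ℓ → c * pairs ℓ′ ≤ q * t ℓ′)
    (schemes : ∀ ℓ → r ≤ ℓ → SchemeFor ℓ)
    {V : Set} (w : V → V → ℕ) (w-sym : ∀ x y → w x y ≡ w y x)
    (p q : ℕ) (pM≤q : p * M ≤ q) where

    open Growth w w-sym M p q pM≤q t

    -- What rainbow-freeness says about multiplicities alone: every r-clique violates the greedy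
    -- condition. It passes to sublists.
    Sparse : List V → Set
    Sparse vs = ∀ S vs′ → vs ↭ S ++ vs′ → length S ≡ r →
      ¬ (∀ {i} → i ≤ M → pairSum (λ x y → indicator≤ i (w x y)) S ≤ i)

    -- Strong induction: sparsity and density both survive the deletion of a clique, and a clique
    -- grown to `r` vertices would contradict sparsity.
    pairSum-critical : ∀ vs → Sparse vs → p * M * pairs (length vs) ≤ q * t (length vs) →
      pairSum h vs ≤ q * t (length vs)
    pairSum-critical vs = <-rec P go (length vs) vs ≡.refl
      where
      P : ℕ → Set
      P ℓ = ∀ vs → length vs ≡ ℓ → Sparse vs → p * M * pairs (length vs) ≤ q * t (length vs) →
        pairSum h vs ≤ q * t (length vs)
      go : ∀ ℓ → (∀ {ℓ′} → ℓ′ < ℓ → P ℓ′) → P ℓ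
      go _ rec vs ≡.refl sparse dense with <-≤-connex (length vs) r
      -- Below `r` vertices the Turán graph is complete, so the bound `q` per edge suffices.
      ... | inj₁ small = ≤-trans (pairSum-mono (λ x y → cost-≤ M p q pM≤q (w x y)) vs)
        (≤-reflexive (≡.trans (pairSum-const q vs)
          (≡.trans (*-comm (pairs (length vs)) q) (cong (q *_) (sym (t-small small))))))
      ... | inj₂ r≤ℓ
        with record { A = A ; B = B ; ℓ₀ = ℓ₀ ; ℓ₀≤ℓ = ℓ₀≤ℓ ; 0<β = 0<β ; valid = valid ; rainbow = rainbow }
             ← schemes (length vs) r≤ℓ
        with grows (scheme A B ℓ₀) 0<β (βp≤αq ℓ₀ ℓ₀≤ℓ) vs ih r (λ s 2≤s s<r → valid s<r 2≤s)
                   (s≤s (s≤s z≤n)) dense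
        where
        βp≤αq : ∀ ℓ₀ → ℓ₀ ≤ length vs → M * pairs ℓ₀ * p ≤ t ℓ₀ * q
        βp≤αq ℓ₀ le = ≤-trans (≤-reflexive (eq M (pairs ℓ₀) p))
          (≤-trans (dense-≤ (p * M) q le dense) (≤-reflexive (*-comm q (t ℓ₀))))
          where
          eq : ∀ M a p → M * a * p ≡ p * M * a
          eq = solve-∀
        ih : ∀ S vs′ → vs ↭ S ++ vs′ → 2 ≤ length S → pairSum h vs′ ≤ q * t (length vs′)
        ih S vs′ perm 2≤s = rec vs′<vs vs′ ≡.refl
          (λ S₁ vs″ perm′ → sparse S₁ (S ++ vs″)
            (trans perm (trans (++⁺ˡ S perm′) (shifts S S₁))))
          (dense-≤ (p * M) q (<⇒≤ vs′<vs) dense)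
          where
          vs′<vs : length vs′ < length vs
          vs′<vs = ≤-trans (+-monoˡ-≤ (length vs′) (≤-trans (s≤s z≤n) 2≤s))
                     (≤-reflexive (sym (≡.trans (↭-length perm) (length-++ S))))
      ...   | inj₁ le = le
      ...   | inj₂ (S , vs′ , perm , g , len) = ⊥-elim (sparse S vs′ perm len λ {i} i≤M →
        ≤-trans (Grown-light (scheme A B ℓ₀) 0<β _ i≤M g)
                (subst (λ l → Counting.lightBound (scheme A B ℓ₀) l i ≤ i) (sym len) (rainbow (s≤s i≤M))))

-- Numerical data for r = 4 and r = 5.

t₃ : ℕ → ℕ
t₃ 0 = 0
t₃ 1 = 0
t₃ 2 = 1
t₃ (suc (suc (suc n))) = t₃ n + (2 * n + 3)

t₄ : ℕ → ℕ
t₄ 0 = 0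
t₄ 1 = 0
t₄ 2 = 1
t₄ 3 = 3
t₄ (suc (suc (suc (suc n)))) = t₄ n + (3 * n + 6)

module K₄ where
  -- The recursive clause of `t₃` is `t-step` for three parts, since `pairs 3` is 3.
  open TuránSequence 2 t₃ (λ _ → ≡.refl)

  open Critical 2 5 t₃ public

  t₃-small : ∀ {ℓ} → ℓ < 4 → t₃ ℓ ≡ pairs ℓ
  t₃-small = toWitness {a? = allUpTo? (λ ℓ → t₃ ℓ ≟ pairs ℓ) 4} tt

  dense₃-≤ : ∀ c q {ℓ ℓ′} → ℓ′ ≤ ℓ → c * pairs ℓ ≤ q * t₃ ℓ → c * pairs ℓ′ ≤ q * t₃ ℓ′
  dense₃-≤ = dense-≤ (ratio (slope (toWitness {a? = allUpTo? slope? 3} tt))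
                            (toWitness {a? = allUpTo? ratio? 3} tt))

  schemes : ∀ ℓ → 4 ≤ ℓ → SchemeFor ℓ
  schemes ℓ 4≤ℓ = record
    { A = λ _ → 3
    ; B = λ s → 2 * s
    -- As `t₃ 4` is 5, density gives `q / p` at least 5 · 6 / 5 = 6.
    ; ℓ₀ = 4
    ; ℓ₀≤ℓ = 4≤ℓ
    ; 0<β = s≤s z≤n
    ; valid = λ {s} s<4 2≤s → s≤s z≤n , subst
        (λ n → 3 * (pairs s + t₃ (ℓ ∸ s)) + 2 * s * (ℓ ∸ s) ≤ 3 * t₃ n)
        (m+[n∸m]≡n (≤-trans (<⇒≤ s<4) 4≤ℓ))
        (deletion s (toWitness {a? = allUpTo? (λ s → allUpTo? (deletion? s) 3) 4} tt s<4) (ℓ ∸ s))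
    ; rainbow = toWitness {a? = rainbow? (scheme (λ _ → 3) (λ s → 2 * s) 4)} tt
    }

module K₅ where
  open TuránSequence 3 t₄ (λ _ → ≡.refl)

  open Critical 3 9 t₄ public

  t₄-small : ∀ {ℓ} → ℓ < 5 → t₄ ℓ ≡ pairs ℓ
  t₄-small = toWitness {a? = allUpTo? (λ ℓ → t₄ ℓ ≟ pairs ℓ) 5} tt

  dense₄-≤ : ∀ c q {ℓ ℓ′} → ℓ′ ≤ ℓ → c * pairs ℓ ≤ q * t₄ ℓ → c * pairs ℓ′ ≤ q * t₄ ℓ′
  dense₄-≤ = dense-≤ (ratio (slope (toWitness {a? = allUpTo? slope? 4} tt))
                            (toWitness {a? = allUpTo? ratio? 4} tt))

  -- The average thresholds of largeScheme meet the rainbow condition at i = 8 only if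
  -- q / p ≥ 32 / 3, which density provides from ℓ = 9 on.  For smaller ℓ the exact
  -- thresholds are needed.
  A′ B′ : ℕ → ℕ → ℕ
  A′ ℓ s = ℓ ∸ s
  B′ ℓ s = t₄ ℓ ∸ (pairs s + t₄ (ℓ ∸ s))

  smallScheme : ∀ {ℓ} → 5 ≤ ℓ → ℓ < 9 → SchemeFor ℓ
  smallScheme {ℓ} 5≤ℓ ℓ<9 = record
    { A = A′ ℓ
    ; B = B′ ℓ
    -- The full strength of density at `ℓ`; only `ℓ` from 5 to 8 have to be evaluated.
    ; ℓ₀ = ℓ
    ; ℓ₀≤ℓ = ≤-refl
    ; 0<β = proj₁ (w ℓ<9 5≤ℓ)
    ; valid = proj₁ (proj₂ (w ℓ<9 5≤ℓ))
    ; rainbow = proj₂ (proj₂ (w ℓ<9 5≤ℓ))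
    }
    where
    w : ∀ {ℓ} → ℓ < 9 → 5 ≤ ℓ →
      0 < 9 * pairs ℓ × Valid (scheme (A′ ℓ) (B′ ℓ) ℓ) ℓ × Rainbow (scheme (A′ ℓ) (B′ ℓ) ℓ)
    w = toWitness {a? = allUpTo? (λ ℓ → (5 ≤? ℓ) →-dec ((0 <? 9 * pairs ℓ) ×-dec
          (valid? (scheme (A′ ℓ) (B′ ℓ) ℓ) ℓ ×-dec rainbow? (scheme (A′ ℓ) (B′ ℓ) ℓ)))) 9} tt

  largeScheme : ∀ ℓ → 9 ≤ ℓ → SchemeFor ℓ
  largeScheme ℓ 9≤ℓ = record
    { A = λ _ → 4
    ; B = λ s → 3 * s
    -- As `t₄ 9` is 30, density gives `q / p` at least 9 · 36 / 30 = 54 / 5, just above 32 / 3.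
    ; ℓ₀ = 9
    ; ℓ₀≤ℓ = 9≤ℓ
    ; 0<β = s≤s z≤n
    ; valid = λ {s} s<5 2≤s → s≤s z≤n , subst
        (λ n → 4 * (pairs s + t₄ (ℓ ∸ s)) + 3 * s * (ℓ ∸ s) ≤ 4 * t₄ n)
        (m+[n∸m]≡n (≤-trans (<⇒≤ s<5) (≤-trans (toWitness {a? = 5 ≤? 9} tt) 9≤ℓ)))
        (deletion s (toWitness {a? = allUpTo? (λ s → allUpTo? (deletion? s) 4) 5} tt s<5) (ℓ ∸ s))
    ; rainbow = toWitness {a? = rainbow? (scheme (λ _ → 4) (λ s → 3 * s) 9)} tt
    }

  schemes : ∀ ℓ → 5 ≤ ℓ → SchemeFor ℓ
  schemes ℓ 5≤ℓ with <-≤-connex ℓ 9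
  ... | inj₁ ℓ<9 = smallScheme 5≤ℓ ℓ<9
  ... | inj₂ 9≤ℓ = largeScheme ℓ 9≤ℓ

-- Lists of pairs and distinct representatives.

module _ {A : Set} where

  allPairs : List A → List (A × A)
  allPairs []       = []
  allPairs (x ∷ xs) = map (x ,_) xs ++ allPairs xs

  length-allPairs : ∀ xs → length (allPairs xs) ≡ pairs (length xs)
  length-allPairs []       = ≡.refl
  length-allPairs (x ∷ xs) = ≡.trans (length-++ (map (x ,_) xs))
    (cong₂ _+_ (length-map (x ,_) xs) (length-allPairs xs))

  sum-allPairs : ∀ (f : A → A → ℕ) xs → sum (map (uncurry f) (allPairs xs)) ≡ pairSum f xs
  sum-allPairs f []       = ≡.refl
  sum-allPairs f (x ∷ xs) = begin
    sum (map (uncurry f) (map (x ,_) xs ++ allPairs xs))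
      ≡⟨ cong sum (map-++ (uncurry f) (map (x ,_) xs) _) ⟩
    sum (map (uncurry f) (map (x ,_) xs) ++ map (uncurry f) (allPairs xs))
      ≡⟨ sum-++ (map (uncurry f) (map (x ,_) xs)) _ ⟩
    sum (map (uncurry f) (map (x ,_) xs)) + sum (map (uncurry f) (allPairs xs))
      ≡⟨ cong₂ _+_ (cong sum (sym (map-∘ xs))) (sum-allPairs f xs) ⟩
    sum (map (f x) xs) + pairSum f xs ∎
    where open ≡-Reasoning

  ∈-allPairs : ∀ xs (a b : Fin (length xs)) → toℕ a < toℕ b → (lookup xs a , lookup xs b) ∈ allPairs xs
  ∈-allPairs (x ∷ xs) zero    (suc b) _         = ∈-++⁺ˡ (∈-map⁺ (x ,_) (∈-lookup {xs = xs} b))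
  ∈-allPairs (x ∷ xs) (suc a) (suc b) (s≤s a<b) = ∈-++⁺ʳ (map (x ,_) xs) (∈-allPairs xs a b a<b)

  lookup-injective : ∀ {xs : List A} → Unique xs → ∀ a b → lookup xs a ≡ lookup xs b → a ≡ b
  lookup-injective (x∉ ∷ u) zero    zero    eq = ≡.refl
  lookup-injective (x∉ ∷ u) zero    (suc b) eq = ⊥-elim (All.lookup x∉ (∈-lookup b) eq)
  lookup-injective (x∉ ∷ u) (suc a) zero    eq = ⊥-elim (All.lookup x∉ (∈-lookup a) (sym eq))
  lookup-injective (x∉ ∷ u) (suc a) (suc b) eq = cong suc (lookup-injective u a b eq)

  Unique-++⁻ˡ : ∀ (xs : List A) {ys} → Unique (xs ++ ys) → Unique xs
  Unique-++⁻ˡ []       u        = []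
  Unique-++⁻ˡ (x ∷ xs) (x∉ ∷ u) = All.++⁻ˡ xs x∉ ∷ Unique-++⁻ˡ xs u

  pairSum-map : ∀ {B : Set} (f : B → B → ℕ) (g : A → B) xs →
    pairSum f (map g xs) ≡ pairSum (λ x y → f (g x) (g y)) xs
  pairSum-map f g []       = ≡.refl
  pairSum-map f g (x ∷ xs) = cong₂ _+_ (cong sum (sym (map-∘ xs))) (pairSum-map f g xs)

  sum-pairSum-comm : ∀ {B : Set} (f : B → A → A → ℕ) bs xs →
    sum (map (λ b → pairSum (f b) xs) bs) ≡ pairSum (λ x y → sum (map (λ b → f b x y) bs)) xs
  sum-pairSum-comm f []       xs = sym (≡.trans (pairSum-const 0 xs) (*-zeroʳ (pairs (length xs))))
  sum-pairSum-comm f (b ∷ bs) xs =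
    ≡.trans (cong (pairSum (f b) xs +_) (sum-pairSum-comm f bs xs)) (sym (pairSum-+ (f b) _ xs))

module _ {Colour : Set} (_≟Colour_ : DecidableEquality Colour) where

  length-without : ∀ u {xs : List Colour} → Unique xs → length xs ≤ suc (length (filter (λ x → ¬? (u ≟Colour x)) xs))
  length-without u [] = z≤n
  length-without u {x ∷ xs} (x∉ ∷ uniq) with u ≟Colour x
  ... | no  _      = s≤s (length-without u uniq)
  ... | yes ≡.refl = s≤s (≤-reflexive (cong length (sym (filter-all (λ y → ¬? (x ≟Colour y)) x∉))))

  -- Forbidden colours are filtered out one by one, and each costs a duplicate-free list at most one
  -- entry.
  fresh : ∀ us {xs : List Colour} → Unique xs → length us < length xs → ∃[ x ] x ∈ xs × x ∉ us
  fresh []       {x ∷ xs} uniq lt = x , here ≡.refl , λ ()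
  fresh (u ∷ us) {xs}     uniq lt
    with x , x∈ , x∉ ← fresh us (Unique.filter⁺ (λ x → ¬? (u ≟Colour x)) uniq)
                             (≤-pred (≤-trans lt (length-without u uniq)))
    with x∈xs , u≢x ← ∈-filter⁻ (λ x → ¬? (u ≟Colour x)) {xs = xs} x∈ =
    x , x∈xs , λ where
      (here eq)  → u≢x (sym eq)
      (there x∈us) → x∉ x∈us

  module _ {E : Set} (_≟E_ : DecidableEquality E) (col : E → List Colour) (col-unique : ∀ e → Unique (col e)) where

    find-long : ∀ i es → sum (map (λ e → indicator≤ i (length (col e))) es) < length es →
      ∃[ e ] ∃[ es′ ] es ↭ e ∷ es′ × i < length (col e)
    find-long i (e ∷ es) lt with length (col e) ≤? i
    ... | no  ≰i = e , es , refl , ≰⇒> ≰i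
    ... | yes _  with e′ , es′ , perm , long ← find-long i es (≤-pred lt) =
      e′ , e ∷ es′ , trans (prep e perm) (swap e e′ refl) , long

    -- Colouring greedily in order of increasing length: the list coloured last
    -- is longer than the number of colours already used.
    distinct-representatives : Colour → ∀ es →
      (∀ {i} → i < length es → sum (map (λ e → indicator≤ i (length (col e))) es) ≤ i) →
      ∃[ c ] (∀ {e} → e ∈ es → c e ∈ col e) ×
             (∀ {e e′} → e ∈ es → e′ ∈ es → c e ≡ c e′ → e ≡ e′)
    distinct-representatives c₀ es few = go (length es) es ≡.refl few
      where
      go : ∀ m es → length es ≡ m →
        (∀ {i} → i < m → sum (map (λ e → indicator≤ i (length (col e))) es) ≤ i) →
        ∃[ c ] (∀ {e} → e ∈ es → c e ∈ col e) ×
               (∀ {e e′} → e ∈ es → e′ ∈ es → c e ≡ c e′ → e ≡ e′)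
      -- The representatives form a total function on `E`, hence the default `c₀`.
      go zero    [] eq few = (λ _ → c₀) , (λ ()) , (λ ())
      go (suc m) es eq few
        -- By `few` at `m`, at most `m` of the `m + 1` lists have length at most `m`. Setting a
        -- longer one aside only lowers the counts for smaller `i`.
        with e₀ , es′ , perm , long ← find-long m es (≤-trans (s≤s (few ≤-refl)) (≤-reflexive (sym eq)))
        with len′ ← suc-injective (≡.trans (sym (↭-length perm)) eq)
        with c , c∈ , c-inj ← go m es′ len′ (λ {i} i<m →
               ≤-trans (≤-trans (m≤n+m _ (indicator≤ i (length (col e₀))))
                                (≤-reflexive (sym (sum-↭ (map⁺ _ perm)))))
                       (few (m≤n⇒m≤1+n i<m)))
        with x , x∈ , x∉ ← fresh (map c es′) (col-unique e₀)
               (≤-trans (≤-reflexive (cong suc (≡.trans (length-map c es′) len′))) long) =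
        c′ , (λ e∈ → c′∈ (∈-resp-↭ perm e∈)) ,
        λ e∈ e′∈ → c′-inj (∈-resp-↭ perm e∈) (∈-resp-↭ perm e′∈)
        where
        c′ : E → Colour
        c′ e with e ≟E e₀
        ... | yes _ = x
        ... | no  _ = c e
        in-tail : ∀ {e} → e ≢ e₀ → e ∈ e₀ ∷ es′ → e ∈ es′
        in-tail e≢ (here eq)  = ⊥-elim (e≢ eq)
        in-tail e≢ (there e∈) = e∈
        c′∈ : ∀ {e} → e ∈ e₀ ∷ es′ → c′ e ∈ col e
        c′∈ {e} e∈ with e ≟E e₀
        ... | yes ≡.refl = x∈
        ... | no  e≢     = c∈ (in-tail e≢ e∈)
        c′-inj : ∀ {e e′} → e ∈ e₀ ∷ es′ → e′ ∈ e₀ ∷ es′ → c′ e ≡ c′ e′ → e ≡ e′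
        c′-inj {e} {e′} e∈ e′∈ ce≡ with e ≟E e₀ | e′ ≟E e₀
        ... | yes p | yes q = ≡.trans p (sym q)
        ... | yes p | no  q = ⊥-elim (x∉ (subst (_∈ map c es′) (sym ce≡) (∈-map⁺ c (in-tail q e′∈))))
        ... | no  p | yes q = ⊥-elim (x∉ (subst (_∈ map c es′) ce≡ (∈-map⁺ c (in-tail p e∈))))
        ... | no  p | no  q = c-inj (in-tail p e∈) (in-tail q e′∈) ce≡

-- Multiplicities in a family of graphs and rainbow cliques.

bit : Bool → ℕ
bit b = if b then 1 else 0

module _ {k n : ℕ} (𝒢 : Family k n) where

  colours : Fin n → Fin n → List (Fin k)
  colours x y = filter (λ c → adj (𝒢 c) x y Bool.≟ true) (allFin k)

  -- A sum over the graphs instead of the length of `colours`, so that it can be exchanged with the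
  -- sum over pairs.
  multiplicity : Fin n → Fin n → ℕ
  multiplicity x y = sum (map (λ c → bit (adj (𝒢 c) x y)) (allFin k))

  multiplicity-sym : ∀ x y → multiplicity x y ≡ multiplicity y x
  multiplicity-sym x y = cong sum (map-cong (λ c → cong bit (Graph.sym (𝒢 c) x y)) (allFin k))

  multiplicity-≤ : ∀ x y → multiplicity x y ≤ k
  multiplicity-≤ x y = ≤-trans (sum-map-mono (λ c → bit≤1 (adj (𝒢 c) x y)) (allFin k))
    (≤-reflexive (≡.trans (sum-map-const 1 (allFin k)) (≡.trans (*-identityʳ _) (length-tabulate id))))
    where
    bit≤1 : ∀ b → bit b ≤ 1
    bit≤1 true  = ≤-refl
    bit≤1 false = z≤n

  length-colours : ∀ x y → length (colours x y) ≡ multiplicity x y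
  length-colours x y = go (allFin k)
    where
    go : ∀ cs → length (filter (λ c → adj (𝒢 c) x y Bool.≟ true) cs) ≡ sum (map (λ c → bit (adj (𝒢 c) x y)) cs)
    go []       = ≡.refl
    go (c ∷ cs) with adj (𝒢 c) x y
    ... | true  = cong suc (go cs)
    ... | false = go cs

  -- The list of an edge consists of the graphs containing it, so distinct representatives are a
  -- rainbow colouring.
  rainbow-clique : 0 < k → ∀ {S r} → Unique S → length S ≡ r →
    (∀ {i} → i < pairs r → pairSum (λ x y → indicator≤ i (multiplicity x y)) S ≤ i) → RainbowKr r 𝒢
  rainbow-clique 0<k {S} uniq ≡.refl few
    with c , c∈ , c-inj ← distinct-representatives Fin._≟_ (≡-dec Fin._≟_ Fin._≟_) (uncurry colours)
           (λ (x , y) → Unique.filter⁺ (λ c → adj (𝒢 c) x y Bool.≟ true) (Unique.allFin⁺ k))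
           (fromℕ< 0<k) (allPairs S)
           (λ {i} i<m → ≤-trans
             (≤-reflexive (≡.trans (sum-allPairs _ S)
               (pairSum-cong (λ x y → cong (indicator≤ i) (length-colours x y)) S)))
             (few (≤-trans i<m (≤-reflexive (length-allPairs S))))) =
    lookup S ,
    (λ a b → c (lookup S a , lookup S b)) ,
    lookup-injective uniq ,
    (λ a b a′ b′ a<b a′<b′ eq →
      let eq₁ , eq₂ = ,-injective (c-inj (∈-allPairs S a b a<b) (∈-allPairs S a′ b′ a′<b′) eq)
      in lookup-injective uniq a a′ eq₁ , lookup-injective uniq b b′ eq₂) ,
    (λ a b a<b → proj₂ (∈-filter⁻ (λ c → adj (𝒢 c) (lookup S a) (lookup S b) Bool.≟ true)
                          {xs = allFin k} (c∈ (∈-allPairs S a b a<b))))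

allFin-suc : ∀ n → allFin (suc n) ≡ zero ∷ map suc (allFin n)
allFin-suc n = cong (zero ∷_) (sym (map-tabulate id suc))

edgeCount-pairSum : ∀ {n} (G : Graph n) → edgeCount G ≡ pairSum (λ x y → bit (adj G x y)) (allFin n)
edgeCount-pairSum G = go _ (adj G)
  where
  entry : ∀ {n} → (Fin n → Fin n → Bool) → Fin n → Fin n → ℕ
  entry a i j = if (toℕ i <ᵇ toℕ j) ∧ a i j then 1 else 0
  -- Induction peels off vertex 0: its row is the first star, and its column vanishes by evaluation
  -- of `<ᵇ`. An arbitrary matrix `a` lets the submatrix on the other vertices be passed on
  -- directly.
  go : ∀ n (a : Fin n → Fin n → Bool) →
    sum (map (λ i → sum (map (entry a i) (allFin n))) (allFin n)) ≡ pairSum (λ x y → bit (a x y)) (allFin n)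
  go zero    a = ≡.refl
  go (suc n) a = subst
    (λ xs → sum (map (λ i → sum (map (entry a i) xs)) xs) ≡ pairSum (λ x y → bit (a x y)) xs)
    (sym (allFin-suc n)) (cong₂ _+_
    (cong sum (≡.trans (sym (map-∘ (allFin n))) (map-∘ (allFin n))))
    (begin
      sum (map (λ i → sum (map (entry a i) (zero ∷ map suc (allFin n)))) (map suc (allFin n)))
        ≡⟨ cong sum (sym (map-∘ (allFin n))) ⟩
      sum (map (λ i → sum (map (entry a (suc i)) (map suc (allFin n)))) (allFin n))
        ≡⟨ cong sum (map-cong (λ i → cong sum (sym (map-∘ (allFin n)))) (allFin n)) ⟩
      sum (map (λ i → sum (map (entry (λ x y → a (suc x) (suc y)) i) (allFin n))) (allFin n))
        ≡⟨ go n (λ x y → a (suc x) (suc y)) ⟩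
      pairSum (λ x y → bit (a (suc x) (suc y))) (allFin n)
        ≡⟨ sym (pairSum-map (λ x y → bit (a x y)) suc (allFin n)) ⟩
      pairSum (λ x y → bit (a x y)) (map suc (allFin n)) ∎))
    where open ≡-Reasoning

totalEdges-pairSum : ∀ {k n} (𝒢 : Family k n) → totalEdges 𝒢 ≡ pairSum (multiplicity 𝒢) (allFin n)
totalEdges-pairSum {k} {n} 𝒢 = ≡.trans
  (cong sum (map-cong (λ c → edgeCount-pairSum (𝒢 c)) (allFin k)))
  (sum-pairSum-comm (λ c x y → bit (adj (𝒢 c) x y)) (allFin k) (allFin n))

-- The recurrence for the edges of the Turán graph.

upTo-suc : ∀ n → upTo (suc n) ≡ 0 ∷ map suc (upTo n)
upTo-suc n = cong (0 ∷_) (sym (map-upTo suc n))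

map-toℕ-allFin : ∀ n → map toℕ (allFin n) ≡ upTo n
map-toℕ-allFin zero    = ≡.refl
map-toℕ-allFin (suc n) = begin
  map toℕ (allFin (suc n))            ≡⟨ cong (map toℕ) (allFin-suc n) ⟩
  0 ∷ map toℕ (map suc (allFin n))    ≡⟨ cong (0 ∷_) (sym (map-∘ (allFin n))) ⟩
  0 ∷ map (suc ∘ toℕ) (allFin n)      ≡⟨ cong (0 ∷_) (map-∘ (allFin n)) ⟩
  0 ∷ map suc (map toℕ (allFin n))    ≡⟨ cong (λ xs → 0 ∷ map suc xs) (map-toℕ-allFin n) ⟩
  0 ∷ map suc (upTo n)                ≡⟨ sym (upTo-suc n) ⟩
  upTo (suc n)                        ∎
  where open ≡-Reasoning

upTo-+ : ∀ m n → upTo (m + n) ≡ upTo m ++ map (m +_) (upTo n)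
upTo-+ zero    n = sym (map-id (upTo n))
upTo-+ (suc m) n = begin
  upTo (suc m + n)                                          ≡⟨ upTo-suc (m + n) ⟩
  0 ∷ map suc (upTo (m + n))                                ≡⟨ cong (λ xs → 0 ∷ map suc xs) (upTo-+ m n) ⟩
  0 ∷ map suc (upTo m ++ map (m +_) (upTo n))               ≡⟨ cong (0 ∷_) (map-++ suc (upTo m) _) ⟩
  0 ∷ map suc (upTo m) ++ map suc (map (m +_) (upTo n))     ≡⟨ cong (λ xs → 0 ∷ map suc (upTo m) ++ xs) (sym (map-∘ (upTo n))) ⟩
  0 ∷ map suc (upTo m) ++ map (suc m +_) (upTo n)           ≡⟨ cong (_++ map (suc m +_) (upTo n)) (sym (upTo-suc m)) ⟩
  upTo (suc m) ++ map (suc m +_) (upTo n)                   ∎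
  where open ≡-Reasoning

module TuránGraph (K : ℕ) where

  private
    N : ℕ
    N = suc K

  crossing : ℕ → ℕ → ℕ
  crossing x y = bit (not ((x % N) ≡ᵇ (y % N)))

  turán-pairSum : ∀ n → turán N n ≡ pairSum crossing (upTo n)
  turán-pairSum n = ≡.trans (edgeCount-pairSum (turánGraph N n))
    (≡.trans (sym (pairSum-map crossing toℕ (allFin n))) (cong (pairSum crossing) (map-toℕ-allFin n)))

  ≡ᵇ-comm : ∀ x y → (x ≡ᵇ y) ≡ (y ≡ᵇ x)
  ≡ᵇ-comm zero    zero    = ≡.refl
  ≡ᵇ-comm zero    (suc y) = ≡.refl
  ≡ᵇ-comm (suc x) zero    = ≡.refl
  ≡ᵇ-comm (suc x) (suc y) = ≡ᵇ-comm x y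

  -- The first `N` vertices meet every part once and form a clique; each later vertex is adjacent to
  -- all but one of them; shifting by `N` preserves residues, so the later vertices span a copy of
  -- the graph on `n`.
  turán-step : pairSum crossing (upTo N) ≡ pairs N →
    (∀ {a} → a < N → sum (map (λ x → bit (not (a ≡ᵇ (x % N)))) (upTo N)) ≡ K) →
    ∀ n → turán N (N + n) ≡ turán N n + (K * n + pairs N)
  turán-step first row n = begin
    turán N (N + n)
      ≡⟨ turán-pairSum (N + n) ⟩
    pairSum crossing (upTo (N + n))
      ≡⟨ cong (pairSum crossing) (upTo-+ N n) ⟩
    pairSum crossing (upTo N ++ map (N +_) (upTo n))
      ≡⟨ pairSum-++ crossing (λ x y → cong (bit ∘ not) (≡ᵇ-comm (x % N) (y % N))) (upTo N) _ ⟩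
    pairSum crossing (upTo N) + crossSum crossing (upTo N) (map (N +_) (upTo n))
      + pairSum crossing (map (N +_) (upTo n))
      ≡⟨ cong₂ _+_ (cong₂ _+_ first cross) rest ⟩
    pairs N + K * n + turán N n
      ≡⟨ eq (pairs N) (K * n) (turán N n) ⟩
    turán N n + (K * n + pairs N) ∎
    where
    open ≡-Reasoning
    eq : ∀ a b c → a + b + c ≡ c + (b + a)
    eq = solve-∀
    N+-% : ∀ x → (N + x) % N ≡ x % N
    N+-% x = ≡.trans (cong (_% N) (+-comm N x)) ([m+n]%n≡m%n x N)
    cross : crossSum crossing (upTo N) (map (N +_) (upTo n)) ≡ K * n
    cross = begin
      crossSum crossing (upTo N) (map (N +_) (upTo n))
        ≡⟨ cong sum (map-cong (λ y → row (m%n<n y N)) (map (N +_) (upTo n))) ⟩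
      sum (map (λ _ → K) (map (N +_) (upTo n)))
        ≡⟨ sum-map-const K (map (N +_) (upTo n)) ⟩
      length (map (N +_) (upTo n)) * K
        ≡⟨ cong (_* K) (≡.trans (length-map (N +_) (upTo n)) (length-upTo n)) ⟩
      n * K
        ≡⟨ *-comm n K ⟩
      K * n ∎
    rest : pairSum crossing (map (N +_) (upTo n)) ≡ turán N n
    rest = ≡.trans (pairSum-map crossing (N +_) (upTo n))
      (≡.trans (pairSum-cong (λ x y → cong₂ (λ a b → bit (not (a ≡ᵇ b))) (N+-% x) (N+-% y)) (upTo n))
               (sym (turán-pairSum n)))

turán≡t₃ : ∀ n → turán 3 n ≡ t₃ n
turán≡t₃ = periodic-induction 2 _ (toWitness {a? = allUpTo? (λ n → turán 3 n ≟ t₃ n) 3} tt)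
  λ n ih → ≡.trans (TuránGraph.turán-step 2 ≡.refl
    (toWitness {a? = allUpTo? (λ a → sum (map (λ x → bit (not (a ≡ᵇ (x % 3)))) (upTo 3)) ≟ 2) 3} tt) n)
    (cong (_+ (2 * n + 3)) ih)

turán≡t₄ : ∀ n → turán 4 n ≡ t₄ n
turán≡t₄ = periodic-induction 3 _ (toWitness {a? = allUpTo? (λ n → turán 4 n ≟ t₄ n) 4} tt)
  λ n ih → ≡.trans (TuránGraph.turán-step 3 ≡.refl
    (toWitness {a? = allUpTo? (λ a → sum (map (λ x → bit (not (a ≡ᵇ (x % 4)))) (upTo 4)) ≟ 3) 4} tt) n)
    (cong (_+ (3 * n + 6)) ih)

-- From the critical ratio to every k, and the theorem.

nC2≡pairs : ∀ n → n C 2 ≡ pairs n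
nC2≡pairs zero    = ≡.refl
nC2≡pairs (suc n) = ≡.trans (sym (nCk+nC[k+1]≡[n+1]C[k+1] n 1)) (cong₂ _+_ (nC1≡n n) (nC2≡pairs n))

-- The second hypothesis is the case k = X / t of the conclusion, scaled by t;
-- A + k B is linear in k, so it interpolates between k = M and k = X / t.
interpolate : ∀ {A B M X t k} → A + M * B ≤ X → t * A + X * B ≤ X * t → M ≤ k → k * t < X → A + k * B ≤ X
interpolate {A} {B} {M} {X} {t} {k} at-M at-X/t M≤k kt<X =
  *-cancelˡ-≤ (ν + μ * t) {{>-nonZero (≤-trans (m<n⇒0<n∸m kt<X) (m≤m+n ν _))}} (begin
    (ν + μ * t) * (A + k * B)
      ≡⟨ eq₁ ν μ t A B k ⟩
    (ν + μ * t) * A + (ν + μ * t) * k * B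
      ≡⟨ cong (λ z → (ν + μ * t) * A + z * B) slope ⟩
    (ν + μ * t) * A + (ν * M + μ * X) * B
      ≡⟨ eq₂ ν μ t A B M X ⟩
    ν * (A + M * B) + μ * (t * A + X * B)
      ≤⟨ +-mono-≤ (*-monoʳ-≤ ν at-M) (*-monoʳ-≤ μ at-X/t) ⟩
    ν * X + μ * (X * t)
      ≡⟨ eq₃ ν μ X t ⟩
    (ν + μ * t) * X ∎)
  where
  open ≤-Reasoning
  -- Weights expressing `k` as the average of `M` and `X / t`: `ν` for `M` and `μ * t` for `X / t`,
  -- cleared of the division by `t`.
  ν = X ∸ k * t
  μ = k ∸ M
  eq₁ : ∀ ν μ t A B k → (ν + μ * t) * (A + k * B) ≡ (ν + μ * t) * A + (ν + μ * t) * k * B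
  eq₁ = solve-∀
  eq₂ : ∀ ν μ t A B M X → (ν + μ * t) * A + (ν * M + μ * X) * B ≡ ν * (A + M * B) + μ * (t * A + X * B)
  eq₂ = solve-∀
  eq₃ : ∀ ν μ X t → ν * X + μ * (X * t) ≡ (ν + μ * t) * X
  eq₃ = solve-∀
  eq₄ : ∀ ν μ t M → (ν + μ * t) * (M + μ) ≡ ν * M + μ * (ν + (M + μ) * t)
  eq₄ = solve-∀
  slope : (ν + μ * t) * k ≡ ν * M + μ * X
  slope = ≡.trans (cong ((ν + μ * t) *_) (sym (m+[n∸m]≡n M≤k)))
    (≡.trans (eq₄ ν μ t M) (cong (λ z → ν * M + μ * z)
      (≡.trans (cong (λ z → ν + z * t) (m+[n∸m]≡n M≤k)) (m∸n+n≡m (<⇒≤ kt<X)))))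

-- If `k * t` is at least `X`, then p = 1, q = k satisfies the density hypothesis. Otherwise `k`
-- lies between `M`, where every edge costs at most `M`, and the critical ratio, reached by p = t, q
-- = X.
pairSum-≤-max : ∀ {V : Set} (w : V → V → ℕ) vs M k t → M < k → (∀ x y → w x y ≤ k) →
  (∀ p q → p * M ≤ q → p * M * pairs (length vs) ≤ q * t →
    pairSum (λ x y → cost M p q (w x y)) vs ≤ q * t) →
  pairSum w vs ≤ M * pairs (length vs) ⊔ k * t
pairSum-≤-max w vs M k t M<k w≤k critical with <-≤-connex (k * t) X
  where X = M * pairs (length vs)
... | inj₂ X≤kt = ≤-trans (≤-trans (pairSum-mono (λ x y → ≤-cost M (w≤k x y)) vs)
    (critical 1 k (≤-trans (≤-reflexive (*-identityˡ M)) (<⇒≤ M<k))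
      (≤-trans (≤-reflexive (cong (_* pairs (length vs)) (*-identityˡ M))) X≤kt)))
    (m≤n⊔m _ _)
... | inj₁ kt<X = ≤-trans (≤-trans (pairSum-mono (λ x y → ≤-cost M (w≤k x y)) vs) (≤-trans (≤-reflexive (split 1 k))
    (≤-trans (≤-reflexive (cong (_+ k * b) (*-identityˡ a))) (interpolate at-M at-X/t (<⇒≤ M<k) kt<X))))
    (m≤m⊔n _ _)
  where
  X = M * pairs (length vs)
  a = pairSum (λ x y → light M (w x y)) vs
  b = pairSum (λ x y → heavy M (w x y)) vs
  split : ∀ p q → pairSum (λ x y → cost M p q (w x y)) vs ≡ p * a + q * b
  split p q = ≡.trans (pairSum-+ _ _ vs) (cong₂ _+_ (pairSum-* p _ vs) (pairSum-* q _ vs))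
  at-M : a + M * b ≤ X
  at-M = begin
    a + M * b                                       ≡⟨ cong (_+ M * b) (sym (*-identityˡ a)) ⟩
    1 * a + M * b                                   ≡⟨ sym (split 1 M) ⟩
    pairSum (λ x y → cost M 1 M (w x y)) vs         ≤⟨ pairSum-mono (λ x y → cost-≤ M 1 M (≤-reflexive (*-identityˡ M)) (w x y)) vs ⟩
    pairSum (λ _ _ → M) vs                          ≡⟨ pairSum-const M vs ⟩
    pairs (length vs) * M                           ≡⟨ *-comm (pairs (length vs)) M ⟩
    X                                               ∎
    where open ≤-Reasoning
  at-X/t : t * a + X * b ≤ X * t
  at-X/t = ≤-trans (≤-reflexive (sym (split t X))) (critical t X
    (≤-trans (≤-trans (≤-reflexive (*-comm t M)) (*-monoˡ-≤ t (<⇒≤ M<k))) (<⇒≤ kt<X))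
    (≤-reflexive (≡.trans (*-assoc t M _) (*-comm t X))))

module _ (K M : ℕ) (t : ℕ → ℕ) (pairs-r : pairs (2 + K) ≡ suc M)
  (t-small : ∀ {ℓ} → ℓ < 2 + K → t ℓ ≡ pairs ℓ)
  (dense-≤ : ∀ c q {ℓ ℓ′} → ℓ′ ≤ ℓ → c * pairs ℓ ≤ q * t ℓ → c * pairs ℓ′ ≤ q * t ℓ′)
  (schemes : ∀ ℓ → 2 + K ≤ ℓ → Critical.SchemeFor K M t ℓ)
  where

  open Critical K M t

  private
    r : ℕ
    r = 2 + K

  totalEdges-≤ : ∀ {k n} (𝒢 : Family k n) → M < k → RainbowKrFree r 𝒢 →
    totalEdges 𝒢 ≤ M * pairs n ⊔ k * t n
  totalEdges-≤ {k} {n} 𝒢 M<k free = subst (λ ℓ → totalEdges 𝒢 ≤ M * pairs ℓ ⊔ k * t ℓ) (length-tabulate id)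
    (≤-trans (≤-reflexive (totalEdges-pairSum 𝒢))
      (pairSum-≤-max (multiplicity 𝒢) (allFin n) M k (t (length (allFin n))) M<k (multiplicity-≤ 𝒢)
        λ p q pM≤q dense → pairSum-critical t-small dense-≤ schemes (multiplicity 𝒢) (multiplicity-sym 𝒢)
          p q pM≤q (allFin n) sparse dense))
    where
    sparse : ∀ S vs′ → allFin n ↭ S ++ vs′ → length S ≡ r →
      ¬ (∀ {i} → i ≤ M → pairSum (λ x y → indicator≤ i (multiplicity 𝒢 x y)) S ≤ i)
    sparse S vs′ perm len few = free (rainbow-clique 𝒢 (≤-trans (s≤s z≤n) M<k)
      (Unique-++⁻ˡ S (Permutationₛ.Unique-resp-↭ (≡.setoid (Fin n)) (↭⇒↭ₛ perm) (Unique.allFin⁺ n)))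
      -- By `pairs-r`, the indices below the number of edges of the clique are exactly those up to
      -- `M`.
      len (λ i<m → few (≤-pred (≤-trans i<m (≤-reflexive pairs-r)))))

theorem1p4 : (r n k : ℕ) → (r ≡ 4 ⊎ r ≡ 5) → r ∸ 1 ≤ n → r C 2 ≤ k →
    (𝒢 : Family k n) → RainbowKrFree r 𝒢 →
    totalEdges 𝒢 ≤ ((r C 2 ∸ 1) * (n C 2)) ⊔ (k * turán (r ∸ 1) n)
theorem1p4 _ n k (inj₁ ≡.refl) _ 6≤k 𝒢 free rewrite nC2≡pairs n | turán≡t₃ n =
  totalEdges-≤ 2 5 t₃ ≡.refl K₄.t₃-small K₄.dense₃-≤ K₄.schemes 𝒢 6≤k free
theorem1p4 _ n k (inj₂ ≡.refl) _ 10≤k 𝒢 free rewrite nC2≡pairs n | turán≡t₄ n =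
  totalEdges-≤ 3 9 t₄ ≡.refl K₅.t₄-small K₅.dense₄-≤ K₅.schemes 𝒢 10≤k free
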